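{- For every integer $d>3$ there is a constant $c_d>0$ such that the following holds for every prime $p$. Let $\vec{t}=(t_1,\dots,t_{d-1})\in\{1,\dots,p-1\}^{d-1}$, and let $S_{\vec{t}}$ denote the collection of the $2^{d-1}$ partially ordered sets, one for each choice of signs $(\varepsilon_1,\dots,\varepsilon_{d-1})\in\{1,-1\}^{d-1}$, of the form $$\big\{\big((\varepsilon_1 t_1 k)\bmod p,\ \dots,\ (\varepsilon_{d-1}t_{d-1}k)\bmod p,\ k\big)\ \big|\ 0\le k<p\big\}$$ under the product order. Then for each such $\vec{t}$ there exists an element of $S_{\vec{t}}$ whose width is at least $c_d\,p^{1-\frac1d}$.
   Context: For an integer $m$, $m \bmod p$ denotes the representative of $m$ modulo $p$ in $\{0,1,\dots,p-1\}$; the parameter $k$ ranges over integers. The product order on $d$-tuples is $x\le y$ iff $x_i\le y_i$ for all $i$. The width of a finite poset is the size of its largest antichain. -}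

module Defs where

open import Algebra.Definitions.RawSemiring using () renaming (_^_ to pow)
open import Data.Fin.Base using (Fin)
open import Data.Integer.Base using (+_; _◃_; _%ℕ_)
import Data.Integer.Base as ℤ
open import Data.Nat.Base using (ℕ; suc; pred; _<_; _≤_; _^_; NonZero)
import Data.Nat.Properties as ℕ
open import Data.Product.Base using (∃-syntax; _×_; proj₁)
open import Data.Rational.Base using (ℚ; +-*-rawSemiring)
import Data.Rational.Base as ℚ
open import Data.Sign.Base using (Sign)
open import Data.Vec.Base using (Vec; []; _∷_; _∷ʳ_; zipWith)
open import Data.Vec.Relation.Binary.Pointwise.Inductive as Pointwise using (Pointwise; []; _∷_)
open import Level using (0ℓ)
open import Relation.Binary.Bundles using (Poset)
open import Relation.Binary.Definitions using (Antisymmetric)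
open import Relation.Binary.PropositionalEquality
  using (_≡_; _≢_; refl; cong₂; isEquivalence)
import Relation.Binary.Construct.On as On
open import Relation.Nullary.Negation.Core using (¬_)

-- A family indexed by Fin n is automatically injective (up to _≈_) when its
-- members are pairwise incomparable, so n is the cardinality of the antichain.
-- Incomparability is required for both orders of a pair since i and j are
-- arbitrary distinct indices.
record Antichain (P : Poset 0ℓ 0ℓ 0ℓ) (n : ℕ) : Set where
  private module P = Poset P
  field
    element      : Fin n → P.Carrier
    incomparable : ∀ {i j} → i ≢ j → ¬ (element i P.≤ element j)

HasWidth : Poset 0ℓ 0ℓ 0ℓ → ℕ → Set
HasWidth P w = Antichain P w × (∀ n → Antichain P n → n ≤ w)

productPoset : ℕ → Poset 0ℓ 0ℓ 0ℓ
productPoset d = record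
  { Carrier        = Vec ℕ d
  ; _≈_            = _≡_
  ; _≤_            = Pointwise _≤_
  ; isPartialOrder = record
    { isPreorder = record
      { isEquivalence = isEquivalence
      ; reflexive     = λ { refl → Pointwise.refl ℕ.≤-refl }
      ; trans         = Pointwise.trans ℕ.≤-trans
      }
    ; antisym = antisym
    }
  }
  where
  antisym : ∀ {m} → Antisymmetric _≡_ (Pointwise _≤_ {m})
  antisym []       []       = refl
  antisym (p ∷ ps) (q ∷ qs) = cong₂ _∷_ (ℕ.≤-antisym p q) (antisym ps qs)

-- s ◃ t is the integer with sign s and absolute value t, and i %ℕ p is the
-- representative of i modulo p in {0, …, p-1}, also for negative i.
point : ∀ {n} (p : ℕ) .{{_ : NonZero p}} → Vec Sign n → Vec ℕ n → ℕ → Vec ℕ (suc n)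
point p ε t k = zipWith (λ s tᵢ → ((s ◃ tᵢ) ℤ.* + k) %ℕ p) ε t ∷ʳ k

-- The collection S_t as a family indexed by the sign vectors ε.  Each member is
-- a subset of the tuples: equality and order compare tuples only, ignoring the
-- witness k.
S : ∀ {n} (p : ℕ) .{{_ : NonZero p}} → Vec ℕ n → Vec Sign n → Poset 0ℓ 0ℓ 0ℓ
S {n} p t ε = On.poset (productPoset (suc n)) (proj₁ {B = InSet})
  where
  InSet : Vec ℕ (suc n) → Set
  InSet x = ∃[ k ] (k < p × x ≡ point p ε t k)

infix 4 _·_^[1-1/_]≤_

-- c · p^(1 - 1/d) ≤ w for c ≥ 0 and d ≥ 1, with both sides (nonnegative reals)
-- raised to the d-th power so that only rational numbers occur.
_·_^[1-1/_]≤_ : ℚ → ℕ → ℕ → ℕ → Set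
c · p ^[1-1/ d ]≤ w =
  pow +-*-rawSemiring c d ℚ.* (+ (p ^ pred d) ℚ./ 1) ℚ.≤ + (w ^ d) ℚ./ 1

{-# OPTIONS --safe #-}

-- By Dirichlet's pigeonhole argument there is a nonzero integer vector m with
-- |mᵢ| ≤ B = ⌊p^(1/d)⌋ and m · (1, t) ≡ 0 (mod p).  If ε is chosen such that
-- all mᵢ εᵢ have the same sign, then the functional x ↦ Σ |mᵢ| xᵢ takes only
-- multiples of p on the poset, and it is bounded by d B (p - 1).  Hence there
-- are at most d B level sets, and the largest of them has at least p / (d B)
-- elements.  A level set is an antichain: comparable points of it agree in
-- every coordinate with mᵢ ≠ 0, and each coordinate of a point determines k.

module Submission where

open import Defs
open import Data.Fin.Base as Fin using (Fin; zero; suc; toℕ; fromℕ<; combine; finToFun; funToFin)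
import Data.Fin.Properties as Fin
open import Data.Integer.Base using (ℤ; +_; 0ℤ; 1ℤ; _⊖_; _◃_; ∣_∣; sign; _%ℕ_; _/ℕ_)
import Data.Integer.Base as ℤ
open import Data.Integer.DivMod using (a≡a%ℕn+[a/ℕn]*n; n%ℕd<d)
import Data.Integer.Properties as ℤ
import Data.Integer.Tactic.RingSolver as ℤRing
open import Data.List.Base as List using (List; []; _∷_; length; filter; allFin)
import Data.List.Properties as List
open import Data.List.Membership.Propositional.Properties using (∈-lookup)
import Data.List.Relation.Binary.Sublist.Propositional.Properties as Sublist
open import Data.List.Relation.Unary.All as ListAll using ([]; _∷_)
import Data.List.Relation.Unary.All.Properties as ListAll
open import Data.List.Relation.Unary.Unique.Propositional using (Unique; []; _∷_)
import Data.List.Relation.Unary.Unique.Propositional.Properties as Unique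
open import Data.Nat.Base
open import Data.Nat.Divisibility using (_∣_; divides; >⇒∤)
open import Data.Nat.DivMod using (_/_; m/n*n≡m; m<n*o⇒m/o<n; m<n⇒m%n≡m)
open import Data.Nat.Primality using (Prime; euclidsLemma; prime⇒nonTrivial)
open import Data.Nat.Properties
import Data.Nat.Tactic.RingSolver as ℕRing
open import Data.Product.Base using (∃-syntax; _×_; _,_; proj₁; proj₂)
open import Data.Rational.Base using (0ℚ) renaming (_<_ to _<ℚ_)
import Data.Rational.Base as ℚ
import Data.Rational.Properties as ℚ
import Data.Rational.Unnormalised.Base as ℚᵘ
import Data.Rational.Unnormalised.Properties as ℚᵘ
import Data.Sign.Base as Sign
open import Data.Sign.Base using (Sign)
open import Data.Sign.Properties using (s*s≡+)
open import Data.Sum.Base using (_⊎_; inj₁; inj₂; [_,_]′)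
open import Data.Vec.Base using (Vec; []; _∷_; _∷ʳ_; lookup; map; tabulate; zipWith)
open import Data.Vec.Properties using (lookup∘tabulate; lookup-map; lookup-zipWith)
open import Data.Vec.Relation.Binary.Pointwise.Inductive as Pointwise using (Pointwise; []; _∷_)
open import Data.Vec.Relation.Unary.All using (All; []; _∷_)
import Data.Vec.Relation.Unary.All.Properties as All
open import Algebra.Definitions.RawSemiring using () renaming (_^_ to pow)
open import Function.Base using (_∘_; _$_)
open import Function.Definitions using (Injective)
open import Level using (0ℓ)
open import Relation.Binary.Bundles using (Poset)
import Relation.Binary.Definitions as B
open import Relation.Binary.PropositionalEquality
open import Relation.Nullary.Decidable using (Dec; yes; no; map′; _→-dec_; ¬?; decidable-stable)
open import Relation.Nullary.Negation using (¬_; contradiction)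
open import Relation.Unary using (Pred; Decidable)

-- Existence of the width of a finite poset

-- Downward search from `N`: each failure of `Q` at the current bound lowers that bound by one, and
-- the given solution `n` keeps the search from running past zero. It serves both for the width and
-- for the integer part of a root.
maximum : ∀ {Q : Pred ℕ 0ℓ} → Decidable Q → ∀ N {n} → Q n → (∀ m → Q m → m ≤ N) →
  ∃[ w ] (Q w × (∀ m → Q m → m ≤ w))
maximum Q? N q bound with Q? N
maximum Q? N q bound | yes qN = N , qN , bound
maximum {Q} Q? zero q bound | no ¬q = contradiction (subst Q (n≤0⇒n≡0 (bound _ q)) q) ¬q
maximum {Q} Q? (suc N) q bound | no ¬q =
  maximum Q? N q λ m qm → s≤s⁻¹ (≤∧≢⇒< (bound m qm) λ m≡1+N → ¬q (subst Q m≡1+N qm))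

anyVec? : ∀ {N} n {Q : Pred (Vec (Fin N) n) 0ℓ} → Decidable Q → Dec (∃[ v ] Q v)
anyVec? zero Q? = map′ ([] ,_) (λ { ([] , q) → q }) (Q? [])
anyVec? (suc n) Q? = map′ (λ (i , v , q) → i ∷ v , q) (λ { (i ∷ v , q) → i , v , q })
  (Fin.any? λ i → anyVec? n (Q? ∘ (i ∷_)))

module _ (P : Poset 0ℓ 0ℓ 0ℓ) (_⊑?_ : B.Decidable (Poset._≤_ P)) {N} (enum : Fin N → Poset.Carrier P)
  (index : ∀ x → ∃[ i ] Poset._≈_ P (enum i) x) where

  open Poset P using (Carrier; reflexive; module Eq) renaming (_≤_ to _⊑_; refl to ⊑-refl; trans to ⊑-trans)
  open Antichain

  private
    ix : Carrier → Fin N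
    ix = proj₁ ∘ index

    ix-⊑ : ∀ {x y} → enum (ix x) ⊑ enum (ix y) → x ⊑ y
    ix-⊑ {x} {y} le = ⊑-trans (reflexive (Eq.sym (proj₂ (index x))))
      (⊑-trans le (reflexive (proj₂ (index y))))

  -- Replacing each member by its enumerated representative preserves incomparability, because the
  -- two are `≈`-equal. An exhaustive search through the finitely many vectors of indices therefore
  -- decides the question.
  antichain? : Decidable (Antichain P)
  antichain? n = map′ fromIndices toIndices $ anyVec? n λ v → Fin.all? λ i → Fin.all? λ j →
    ¬? (i Fin.≟ j) →-dec ¬? (enum (lookup v i) ⊑? enum (lookup v j))
    where
    Indices : Set
    Indices = ∃[ v ] (∀ i j → i ≢ j → ¬ (enum (lookup v i) ⊑ enum (lookup v j)))

    fromIndices : Indices → Antichain P n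
    fromIndices (v , inc) = record { element = enum ∘ lookup v ; incomparable = inc _ _ }

    toIndices : Antichain P n → Indices
    toIndices A = tabulate f , λ i j i≢j le → incomparable A i≢j
      (ix-⊑ (subst₂ _⊑_ (cong enum (lookup∘tabulate f i)) (cong enum (lookup∘tabulate f j)) le))
      where f = ix ∘ element A

  -- Two members with the same index would be `≈`-equal and thus comparable, so the index map is
  -- injective on an antichain. Equality in `Fin` is decidable, which turns this refutation into an
  -- equality.
  antichain-≤ : ∀ n → Antichain P n → n ≤ N
  antichain-≤ n A = Fin.injective⇒≤ {f = ix ∘ element A} λ {i} {j} eq →
    decidable-stable (i Fin.≟ j) λ i≢j →
      incomparable A i≢j (ix-⊑ (subst (λ k → enum (ix (element A i)) ⊑ enum k) eq ⊑-refl))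

  -- `HasWidth` asks for an exact maximum. This lemma reduces lower bounds on the width to the
  -- construction of a single antichain.
  antichain⇒hasWidth : ∀ {n} → Antichain P n → ∃[ w ] (HasWidth P w × n ≤ w)
  antichain⇒hasWidth {n} A = let w , Aw , max = maximum antichain? N A antichain-≤ in
    w , (Aw , max) , max n A

-- Pigeonhole principle with a large fibre

unique⇒lookup-injective : ∀ {A : Set} {xs : List A} → Unique xs → Injective _≡_ _≡_ (List.lookup xs)
unique⇒lookup-injective (_ ∷ _)   {zero}  {zero}  _  = refl
unique⇒lookup-injective (x∉ ∷ _)  {zero}  {suc j} eq = contradiction eq (ListAll.lookup x∉ (∈-lookup j))
unique⇒lookup-injective (x∉ ∷ _)  {suc i} {zero}  eq = contradiction (sym eq) (ListAll.lookup x∉ (∈-lookup i))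
unique⇒lookup-injective (_ ∷ uxs) {suc i} {suc j} eq = cong suc (unique⇒lookup-injective uxs eq)

module _ {A : Set} where

  length-filter-⊎ : ∀ {P Q : Pred A 0ℓ} (P? : Decidable P) (Q? : Decidable Q) {xs} →
    ListAll.All (λ x → P x ⊎ Q x) xs →
    length xs ≤ length (filter P? xs) + length (filter Q? xs)
  length-filter-⊎ P? Q? [] = z≤n
  length-filter-⊎ P? Q? {x ∷ xs} (pq ∷ pqs) with ih ← length-filter-⊎ P? Q? pqs | P? x | Q? x
  ... | yes _ | yes _ = s≤s (≤-trans ih (+-monoʳ-≤ (length (filter P? xs)) (n≤1+n _)))
  ... | yes _ | no _  = s≤s ih
  ... | no _  | yes _ = ≤-trans (s≤s ih) (≤-reflexive (sym (+-suc _ _)))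
  ... | no ¬p | no ¬q = contradiction pq [ ¬p , ¬q ]′

  -- Induction on the number of values: the fibre over the top value `D` is split off, the rest has
  -- a large fibre over some `v`, and the larger of these two fibres is large enough for the whole
  -- list.
  largeFibre-List : ∀ D (f : A → ℕ) xs → ListAll.All (λ x → f x < D) xs →
    ∃[ v ] length xs ≤ D * length (filter (λ x → f x ≟ v) xs)
  largeFibre-List zero    f []       _        = 0 , z≤n
  largeFibre-List zero    f (x ∷ xs) (() ∷ _)
  largeFibre-List (suc D) f xs       f<1+D = choose (≤-total (count D) (count v))
    where
    open ≤-Reasoning

    count : ℕ → ℕ
    count u = length (filter (λ x → f x ≟ u) xs)

    below : List A
    below = filter (λ x → f x <? D) xs

    ih : ∃[ v ] length below ≤ D * length (filter (λ x → f x ≟ v) below)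
    ih = largeFibre-List D f below (ListAll.all-filter (λ x → f x <? D) xs)

    v : ℕ
    v = proj₁ ih

    split : ∀ {x} → f x < suc D → f x ≡ D ⊎ f x < D
    split {x} (s≤s fx≤D) with f x ≟ D
    ... | yes fx≡D = inj₁ fx≡D
    ... | no  fx≢D = inj₂ (≤∧≢⇒< fx≤D fx≢D)

    length-≤ : length xs ≤ count D + D * count v
    length-≤ = begin
      length xs
        ≤⟨ length-filter-⊎ (λ x → f x ≟ D) (λ x → f x <? D) (ListAll.map split f<1+D) ⟩
      count D + length below
        ≤⟨ +-monoʳ-≤ (count D) (proj₂ ih) ⟩
      count D + D * length (filter (λ x → f x ≟ v) below)
        -- The fibre over `v` inside `below` is a sublist of the fibre over `v` inside `xs`.
        ≤⟨ +-monoʳ-≤ (count D) (*-monoʳ-≤ D (Sublist.length-mono-≤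
             (Sublist.filter⁺ _ _ (λ { refl eq → eq }) (Sublist.filter-⊆ (λ x → f x <? D) xs)))) ⟩
      count D + D * count v
        ∎

    choose : count D ≤ count v ⊎ count v ≤ count D → ∃[ u ] length xs ≤ suc D * count u
    choose (inj₁ le) = v , ≤-trans length-≤ (+-monoˡ-≤ (D * count v) le)
    choose (inj₂ le) = D , ≤-trans length-≤ (+-monoʳ-≤ (count D) (*-monoʳ-≤ D le))

-- The fibre is presented by an injective enumeration `g`, since an `Antichain` is indexed by
-- `Fin n`.
largeFibre : ∀ {N} D (f : Fin N → ℕ) → (∀ i → f i < D) →
  ∃[ n ] ∃[ g ] (Injective {A = Fin n} {B = Fin N} _≡_ _≡_ g × (∀ i j → f (g i) ≡ f (g j)) × N ≤ D * n)
largeFibre {N} D f f<D =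
  let v , N≤ = largeFibre-List D f (allFin N) (ListAll.tabulate⁺ f<D)
      f≟v = λ x → f x ≟ v
      fibre = filter f≟v (allFin N)
      onFibre = λ i → ListAll.lookup (ListAll.all-filter f≟v (allFin N)) (∈-lookup {xs = fibre} i)
  in length fibre , List.lookup fibre
   , unique⇒lookup-injective (Unique.filter⁺ f≟v (Unique.allFin⁺ N))
   , (λ i j → trans (onFibre i) (sym (onFibre j)))
   , subst (_≤ D * length fibre) (List.length-tabulate {n = N} (λ i → i)) N≤

-- Weighted sums and monotonicity

dot : ∀ {n} → Vec ℕ n → Vec ℕ n → ℕ
dot []       []       = 0
dot (w ∷ ws) (x ∷ xs) = w * x + dot ws xs

dot-≤ : ∀ {n a b} (w x : Vec ℕ n) → (∀ i → lookup w i ≤ a) → (∀ i → lookup x i ≤ b) →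
  dot w x ≤ n * (a * b)
dot-≤ []       []       _   _   = z≤n
dot-≤ (w ∷ ws) (x ∷ xs) w≤a x≤b =
  +-mono-≤ (*-mono-≤ (w≤a zero) (x≤b zero)) (dot-≤ ws xs (w≤a ∘ suc) (x≤b ∘ suc))

dot-monoʳ-≤ : ∀ {n} (w : Vec ℕ n) {x y} → Pointwise _≤_ x y → dot w x ≤ dot w y
dot-monoʳ-≤ []       []         = z≤n
dot-monoʳ-≤ (w ∷ ws) (le ∷ les) = +-mono-≤ (*-monoʳ-≤ w le) (dot-monoʳ-≤ ws les)

+-≤-≡ : ∀ {a b c d} → a ≤ b → c ≤ d → a + c ≡ b + d → a ≡ b × c ≡ d
+-≤-≡ {a} {b} {c} {d} a≤b c≤d eq = a≡b , +-cancelˡ-≡ a c d (trans eq (cong (_+ d) (sym a≡b)))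
  where
  a≡b : a ≡ b
  a≡b = ≤-antisym a≤b (+-cancelʳ-≤ d b a (≤-trans (≤-reflexive (sym eq)) (+-monoʳ-≤ a c≤d)))

-- Every summand grows weakly from `x` to `y`, so equal totals leave no room for growth in any
-- summand, and a nonzero weight can be cancelled. This is why level sets are antichains.
dot-≡⇒lookup-≡ : ∀ {n} (w : Vec ℕ n) {x y} → Pointwise _≤_ x y → dot w x ≡ dot w y →
  ∀ i → lookup w i ≢ 0 → lookup x i ≡ lookup y i
dot-≡⇒lookup-≡ (w ∷ ws) {x ∷ _} {y ∷ _} (le ∷ les) eq i wᵢ≢0
  with i | +-≤-≡ (*-monoʳ-≤ w le) (dot-monoʳ-≤ ws les) eq
... | zero  | wx≡wy , _ = *-cancelˡ-≡ x y w {{≢-nonZero wᵢ≢0}} wx≡wy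
... | suc i | _ , eqs   = dot-≡⇒lookup-≡ ws les eqs i wᵢ≢0

dotℤ : ∀ {n} → Vec ℤ n → Vec ℕ n → ℤ
dotℤ []       []       = 0ℤ
dotℤ (m ∷ ms) (t ∷ ts) = m ℤ.* + t ℤ.+ dotℤ ms ts

dotℤ-⊖ : ∀ {n} (f g : Fin n → ℕ) (t : Vec ℕ n) →
  dotℤ (tabulate λ i → f i ⊖ g i) t ≡ + dot (tabulate f) t ℤ.- + dot (tabulate g) t
dotℤ-⊖ f g []       = refl
dotℤ-⊖ f g (t ∷ ts) = begin
  (f zero ⊖ g zero) ℤ.* + t ℤ.+ dotℤ (tabulate λ i → f (suc i) ⊖ g (suc i)) ts
    ≡⟨ cong₂ (λ a b → a ℤ.* + t ℤ.+ b) (sym (ℤ.m-n≡m⊖n (f zero) (g zero))) (dotℤ-⊖ (f ∘ suc) (g ∘ suc) ts) ⟩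
  (+ f zero ℤ.- + g zero) ℤ.* + t ℤ.+ (+ F ℤ.- + G)
    ≡⟨ distrib (+ f zero) (+ g zero) (+ t) (+ F) (+ G) ⟩
  (+ f zero ℤ.* + t ℤ.+ + F) ℤ.- (+ g zero ℤ.* + t ℤ.+ + G)
    ≡⟨ cong₂ (λ a b → (a ℤ.+ + F) ℤ.- (b ℤ.+ + G)) (ℤ.pos-* (f zero) t) (ℤ.pos-* (g zero) t) ⟨
  + dot (tabulate f) (t ∷ ts) ℤ.- + dot (tabulate g) (t ∷ ts)
    ∎
  where
  open ≡-Reasoning
  F = dot (tabulate (f ∘ suc)) ts
  G = dot (tabulate (g ∘ suc)) ts
  distrib : ∀ a b c d e → (a ℤ.- b) ℤ.* c ℤ.+ (d ℤ.- e) ≡ (a ℤ.* c ℤ.+ d) ℤ.- (b ℤ.* c ℤ.+ e)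
  distrib = ℤRing.solve-∀

-- Small linear relations modulo p

funToFin-cong : ∀ {m n} {f g : Fin m → Fin n} → f ≗ g → funToFin f ≡ funToFin g
funToFin-cong {zero}  eq = refl
funToFin-cong {suc m} eq = cong₂ combine (eq zero) (funToFin-cong (eq ∘ suc))

-- `finToFun` reads off the `n` digits in base `m`, and `funToFin` recovers the number from them.
-- The congruence lemma stands in for function extensionality.
finToFun-injective : ∀ {m n} {i j : Fin (m ^ n)} → finToFun {m} {n} i ≗ finToFun j → i ≡ j
finToFun-injective {m} {n} {i} {j} eq = begin
  i                             ≡⟨ Fin.funToFin-finToFin {n} i ⟨
  funToFin (finToFun {m} {n} i) ≡⟨ funToFin-cong eq ⟩
  funToFin (finToFun {m} {n} j) ≡⟨ Fin.funToFin-finToFin {n} j ⟩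
  j                             ∎
  where open ≡-Reasoning

%ℕ-≡⇒difference : ∀ i j {p} .{{_ : NonZero p}} → i %ℕ p ≡ j %ℕ p →
  i ℤ.- j ≡ (i /ℕ p ℤ.- j /ℕ p) ℤ.* + p
%ℕ-≡⇒difference i j {p} eq = begin
  i ℤ.- j
    ≡⟨ cong₂ ℤ._-_ (a≡a%ℕn+[a/ℕn]*n i p) (a≡a%ℕn+[a/ℕn]*n j p) ⟩
  (+ (i %ℕ p) ℤ.+ i /ℕ p ℤ.* + p) ℤ.- (+ (j %ℕ p) ℤ.+ j /ℕ p ℤ.* + p)
    ≡⟨ cong (λ r → (+ r ℤ.+ i /ℕ p ℤ.* + p) ℤ.- (+ (j %ℕ p) ℤ.+ j /ℕ p ℤ.* + p)) eq ⟩
  (+ (j %ℕ p) ℤ.+ i /ℕ p ℤ.* + p) ℤ.- (+ (j %ℕ p) ℤ.+ j /ℕ p ℤ.* + p)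
    ≡⟨ cancel (+ (j %ℕ p)) (i /ℕ p) (j /ℕ p) (+ p) ⟩
  (i /ℕ p ℤ.- j /ℕ p) ℤ.* + p
    ∎
  where
  open ≡-Reasoning
  cancel : ∀ r a b p → (r ℤ.+ a ℤ.* p) ℤ.- (r ℤ.+ b ℤ.* p) ≡ (a ℤ.- b) ℤ.* p
  cancel = ℤRing.solve-∀

-- There are `suc B ^ n` digit vectors with entries at most `B`, more than there are residues modulo
-- `p`. Two of them have values with the same residue, and their difference is the relation.
smallRelation : ∀ p .{{_ : NonZero p}} {n} B → p < suc B ^ n → (t : Vec ℕ n) →
  ∃[ m ] ((∀ i → ∣ lookup m i ∣ ≤ B) × (∃[ i ] lookup m i ≢ 0ℤ) × ∃[ z ] dotℤ m t ≡ z ℤ.* + p)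
smallRelation p {n} B p<[1+B]^n t = tabulate m , bounded , nonzero , z , relation
  where
  open ≡-Reasoning

  digit : Fin (suc B ^ n) → Fin n → ℕ
  digit c = toℕ ∘ finToFun {suc B} {n} c

  value : Fin (suc B ^ n) → ℕ
  value c = dot (tabulate (digit c)) t

  collision : ∃[ a ] ∃[ b ] (a Fin.< b × fromℕ< (n%ℕd<d (+ value a) p) ≡ fromℕ< (n%ℕd<d (+ value b) p))
  collision = Fin.pigeonhole p<[1+B]^n λ c → fromℕ< (n%ℕd<d (+ value c) p)

  a b : Fin (suc B ^ n)
  a = proj₁ collision
  b = proj₁ (proj₂ collision)

  m : Fin n → ℤ
  m i = digit a i ⊖ digit b i

  bounded : ∀ i → ∣ lookup (tabulate m) i ∣ ≤ B
  bounded i rewrite lookup∘tabulate m i =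
    -- The distance of two naturals is at most the larger one, so the bound is `B` and not `2 * B`.
    ≤-trans (ℤ.∣m⊝n∣≤m⊔n (digit a i) (digit b i)) (⊔-lub (digit≤B a) (digit≤B b))
    where
    digit≤B : ∀ c → digit c i ≤ B
    digit≤B c = s≤s⁻¹ (Fin.toℕ<n (finToFun {suc B} {n} c i))

  nonzero : ∃[ i ] lookup (tabulate m) i ≢ 0ℤ
  nonzero = Fin.¬∀⟶∃¬ n _ (λ i → lookup (tabulate m) i ℤ.≟ 0ℤ) λ m≡0 →
    Fin.<⇒≢ (proj₁ (proj₂ (proj₂ collision))) (finToFun-injective {suc B} {n} λ i → Fin.toℕ-injective (ℤ.+-injective
      (ℤ.i-j≡0⇒i≡j _ _ (trans (ℤ.m-n≡m⊖n (digit a i) (digit b i))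
        (trans (sym (lookup∘tabulate m i)) (m≡0 i))))))

  z : ℤ
  z = + value a /ℕ p ℤ.- + value b /ℕ p

  relation : dotℤ (tabulate m) t ≡ z ℤ.* + p
  relation = begin
    dotℤ (tabulate m) t
      ≡⟨ dotℤ-⊖ (digit a) (digit b) t ⟩
    + value a ℤ.- + value b
      ≡⟨ %ℕ-≡⇒difference (+ value a) (+ value b) (Fin.fromℕ<-injective _ _ _ _ (proj₂ (proj₂ (proj₂ collision)))) ⟩
    z ℤ.* + p
      ∎

-- Choice of signs

◃-≡-* : ∀ s n → s ◃ n ≡ (s ◃ 1) ℤ.* + n
◃-≡-* Sign.+ n = trans (ℤ.+◃n≡+n n) (sym (ℤ.*-identityˡ (+ n)))
◃-≡-* Sign.- n = trans (ℤ.-◃n≡-n n) (sym (ℤ.-1*i≡-i (+ n)))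

-- The factor `sign i` turns `∣ i ∣` back into `i`, so only the sign `s`, common to all coordinates,
-- survives.
∣i∣*-◃ : ∀ s i t → + ∣ i ∣ ℤ.* (s Sign.* sign i ◃ t) ≡ (s ◃ 1) ℤ.* (i ℤ.* + t)
∣i∣*-◃ s i t = begin
  + ∣ i ∣ ℤ.* (s Sign.* sign i ◃ t)
    ≡⟨ cong (+ ∣ i ∣ ℤ.*_) (◃-≡-* (s Sign.* sign i) t) ⟩
  + ∣ i ∣ ℤ.* ((s Sign.* sign i ◃ 1) ℤ.* + t)
    ≡⟨ cong (λ σ → + ∣ i ∣ ℤ.* (σ ℤ.* + t)) (ℤ.◃-distrib-* s (sign i) 1 1) ⟩
  + ∣ i ∣ ℤ.* ((s ◃ 1) ℤ.* (sign i ◃ 1) ℤ.* + t)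
    ≡⟨ rearrange (+ ∣ i ∣) (s ◃ 1) (sign i ◃ 1) (+ t) ⟩
  (s ◃ 1) ℤ.* ((sign i ◃ 1) ℤ.* + ∣ i ∣ ℤ.* + t)
    ≡⟨ cong (λ j → (s ◃ 1) ℤ.* (j ℤ.* + t)) (trans (sym (◃-≡-* (sign i) ∣ i ∣)) (ℤ.signᵢ◃∣i∣≡i i)) ⟩
  (s ◃ 1) ℤ.* (i ℤ.* + t)
    ∎
  where
  open ≡-Reasoning
  rearrange : ∀ a σ τ t → a ℤ.* (σ ℤ.* τ ℤ.* t) ≡ σ ℤ.* (τ ℤ.* a ℤ.* t)
  rearrange = ℤRing.solve-∀

-- Residues and the level function

module _ (p : ℕ) .{{_ : NonZero p}} where

  residue : ℕ → Sign → ℕ → ℕ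
  residue k s t = ((s ◃ t) ℤ.* + k) %ℕ p

  residue-1 : ∀ {k s} → s ≡ Sign.+ → k < p → residue k s 1 ≡ k
  residue-1 {k} refl k<p = trans (cong (_%ℕ p) (ℤ.*-identityˡ (+ k))) (m<n⇒m%n≡m k<p)

  -- Equal residues make `p` divide `t * ∣ k ⊖ l ∣`. By Euclid's lemma it divides a factor, but both
  -- factors are below `p` and `t` is positive, so `∣ k ⊖ l ∣` is zero.
  residue-injective : Prime p → ∀ s {t k l} → 1 ≤ t → t < p → k < p → l < p →
    residue k s t ≡ residue l s t → k ≡ l
  residue-injective pr s {t} {k} {l} 1≤t t<p k<p l<p eq
    with euclidsLemma t ∣ k ⊖ l ∣ pr p∣t*∣k⊖l∣
    where
    open ≡-Reasoning
    i j q : ℤ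
    i = (s ◃ t) ℤ.* + k
    j = (s ◃ t) ℤ.* + l
    q = i /ℕ p ℤ.- j /ℕ p

    distrib : ∀ a b c → a ℤ.* (b ℤ.- c) ≡ a ℤ.* b ℤ.- a ℤ.* c
    distrib = ℤRing.solve-∀

    p∣t*∣k⊖l∣ : p ∣ t * ∣ k ⊖ l ∣
    p∣t*∣k⊖l∣ = divides ∣ q ∣ (begin
      t * ∣ k ⊖ l ∣                    ≡⟨ cong (_* ∣ k ⊖ l ∣) (ℤ.abs-◃ s t) ⟨
      ∣ s ◃ t ∣ * ∣ k ⊖ l ∣            ≡⟨ ℤ.abs-* (s ◃ t) (k ⊖ l) ⟨
      ∣ (s ◃ t) ℤ.* (k ⊖ l) ∣          ≡⟨ cong (λ d → ∣ (s ◃ t) ℤ.* d ∣) (ℤ.m-n≡m⊖n k l) ⟨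
      ∣ (s ◃ t) ℤ.* (+ k ℤ.- + l) ∣    ≡⟨ cong ∣_∣ (distrib (s ◃ t) (+ k) (+ l)) ⟩
      ∣ i ℤ.- j ∣                      ≡⟨ cong ∣_∣ (%ℕ-≡⇒difference i j eq) ⟩
      ∣ q ℤ.* + p ∣                    ≡⟨ ℤ.abs-* q (+ p) ⟩
      ∣ q ∣ * p                        ∎)
  ... | inj₁ p∣t = contradiction p∣t (>⇒∤ {{>-nonZero 1≤t}} t<p)
  ... | inj₂ p∣d with ∣ k ⊖ l ∣ ≟ 0
  ...   | yes d≡0 = ℤ.+-injective (ℤ.i-j≡0⇒i≡j _ _ (trans (ℤ.m-n≡m⊖n k l) (ℤ.∣i∣≡0⇒i≡0 d≡0)))
  ...   | no  d≢0 = contradiction p∣d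
    (>⇒∤ {{≢-nonZero d≢0}} (≤-<-trans (ℤ.∣m⊝n∣≤m⊔n k l) (⊔-lub k<p l<p)))

  -- Definitionally this is `point` without its last entry.
  coords : ∀ {n} → Vec Sign n → Vec ℕ n → ℕ → Vec ℕ n
  coords ε t k = zipWith (residue k) ε t

  -- The entries of the sign vector are `s Sign.* sign mᵢ`, hence the weighted sum of the unreduced
  -- coordinates is `s` times `m · t` times `k`. The free sign `s` permits normalising the sign of
  -- one coordinate.
  level : ∀ {n} → Sign → Vec ℤ n → Vec ℕ n → ℕ → ℕ
  level s m t k = dot (map ∣_∣ m) (coords (map (λ i → s Sign.* sign i) m) t k)

  -- Reducing a coordinate modulo `p` changes the weighted sum by a multiple of `p`; `q` collects
  -- these multiples over all coordinates.
  level-mod : ∀ {n} s (m : Vec ℤ n) t k →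
    ∃[ q ] + level s m t k ≡ (s ◃ 1) ℤ.* dotℤ m t ℤ.* + k ℤ.+ q ℤ.* + p
  level-mod s []       []       k = 0ℤ , vanish (s ◃ 1) (+ k) (+ p)
    where
    vanish : ∀ a b c → 0ℤ ≡ a ℤ.* 0ℤ ℤ.* b ℤ.+ 0ℤ ℤ.* c
    vanish = ℤRing.solve-∀
  level-mod s (m ∷ ms) (t ∷ ts) k with q , ih ← level-mod s ms ts k = q ℤ.- + ∣ m ∣ ℤ.* r , (begin
    + (∣ m ∣ * x + rest)
      ≡⟨ cong₂ ℤ._+_ (ℤ.pos-* ∣ m ∣ x) ih ⟩
    + ∣ m ∣ ℤ.* + x ℤ.+ tail
      ≡⟨ complete (+ ∣ m ∣) (+ x) r (+ p) tail ⟩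
    + ∣ m ∣ ℤ.* (+ x ℤ.+ r ℤ.* + p) ℤ.- + ∣ m ∣ ℤ.* r ℤ.* + p ℤ.+ tail
      ≡⟨ cong (λ y → + ∣ m ∣ ℤ.* y ℤ.- + ∣ m ∣ ℤ.* r ℤ.* + p ℤ.+ tail) (a≡a%ℕn+[a/ℕn]*n _ p) ⟨
    + ∣ m ∣ ℤ.* (u ℤ.* + k) ℤ.- + ∣ m ∣ ℤ.* r ℤ.* + p ℤ.+ tail
      ≡⟨ cong (λ y → y ℤ.- + ∣ m ∣ ℤ.* r ℤ.* + p ℤ.+ tail)
           (trans (sym (ℤ.*-assoc (+ ∣ m ∣) u (+ k))) (cong (ℤ._* + k) (∣i∣*-◃ s m t))) ⟩
    (s ◃ 1) ℤ.* (m ℤ.* + t) ℤ.* + k ℤ.- + ∣ m ∣ ℤ.* r ℤ.* + p ℤ.+ tail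
      ≡⟨ collect (s ◃ 1) (m ℤ.* + t) (+ k) (+ ∣ m ∣ ℤ.* r) (+ p) (dotℤ ms ts) q ⟩
    (s ◃ 1) ℤ.* (m ℤ.* + t ℤ.+ dotℤ ms ts) ℤ.* + k ℤ.+ (q ℤ.- + ∣ m ∣ ℤ.* r) ℤ.* + p
      ∎)
    where
    open ≡-Reasoning
    u r tail : ℤ
    u = s Sign.* sign m ◃ t
    r = (u ℤ.* + k) /ℕ p
    tail = (s ◃ 1) ℤ.* dotℤ ms ts ℤ.* + k ℤ.+ q ℤ.* + p

    x rest : ℕ
    x = residue k (s Sign.* sign m) t
    rest = level s ms ts k

    complete : ∀ a x r p e → a ℤ.* x ℤ.+ e ≡ a ℤ.* (x ℤ.+ r ℤ.* p) ℤ.- a ℤ.* r ℤ.* p ℤ.+ e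
    complete = ℤRing.solve-∀

    collect : ∀ σ a k b p e q →
      σ ℤ.* a ℤ.* k ℤ.- b ℤ.* p ℤ.+ (σ ℤ.* e ℤ.* k ℤ.+ q ℤ.* p) ≡
      σ ℤ.* (a ℤ.+ e) ℤ.* k ℤ.+ (q ℤ.- b) ℤ.* p
    collect = ℤRing.solve-∀

  p∣level : ∀ {n} s (m : Vec ℤ n) t z → dotℤ m t ≡ z ℤ.* + p → ∀ k → p ∣ level s m t k
  p∣level s m t z m·t≡z*p k with q , eq ← level-mod s m t k = divides ∣ h ∣ (begin
    level s m t k
      ≡⟨ cong ∣_∣ eq ⟩
    ∣ (s ◃ 1) ℤ.* dotℤ m t ℤ.* + k ℤ.+ q ℤ.* + p ∣
      ≡⟨ cong (λ y → ∣ (s ◃ 1) ℤ.* y ℤ.* + k ℤ.+ q ℤ.* + p ∣) m·t≡z*p ⟩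
    ∣ (s ◃ 1) ℤ.* (z ℤ.* + p) ℤ.* + k ℤ.+ q ℤ.* + p ∣
      ≡⟨ cong ∣_∣ (factor (s ◃ 1) z (+ p) (+ k) q) ⟩
    ∣ h ℤ.* + p ∣
      ≡⟨ ℤ.abs-* h (+ p) ⟩
    ∣ h ∣ * p
      ∎)
    where
    open ≡-Reasoning
    h : ℤ
    h = (s ◃ 1) ℤ.* z ℤ.* + k ℤ.+ q

    factor : ∀ σ z p k q → σ ℤ.* (z ℤ.* p) ℤ.* k ℤ.+ q ℤ.* p ≡ (σ ℤ.* z ℤ.* k ℤ.+ q) ℤ.* p
    factor = ℤRing.solve-∀

  level-≤ : ∀ {n B} s (m : Vec ℤ n) t → (∀ i → ∣ lookup m i ∣ ≤ B) → ∀ k →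
    level s m t k ≤ n * (B * pred p)
  level-≤ {B = B} s m t m≤B k = dot-≤ (map ∣_∣ m) (coords ε t k)
    (λ i → subst (_≤ B) (sym (lookup-map i ∣_∣ m)) (m≤B i))
    (λ i → subst (_≤ pred p) (sym (lookup-zipWith (residue k) i ε t))
      (<⇒≤pred (n%ℕd<d ((lookup ε i ◃ lookup t i) ℤ.* + k) p)))
    where ε = map (λ i → s Sign.* sign i) m

  -- 1 ∷ t is t preceded by the multiplier of the coordinate k itself.
  level⇒incomparable : Prime p → ∀ {n} m₀ (m : Vec ℤ n) (t : Vec ℕ n) →
    All (λ tᵢ → 1 ≤ tᵢ × tᵢ < p) t → ∀ i → lookup (m₀ ∷ m) i ≢ 0ℤ →
    let s = sign m₀ ; ε = map (λ j → s Sign.* sign j) m in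
    ∀ {k l} → k < p → l < p → level s (m₀ ∷ m) (1 ∷ t) k ≡ level s (m₀ ∷ m) (1 ∷ t) l →
    Pointwise _≤_ (point p ε t k) (point p ε t l) → k ≡ l
  level⇒incomparable pr m₀ m t t-bounds i mᵢ≢0 {k} {l} k<p l<p levels≡ le =
    residue-injective pr (lookup ε⁺ i) (proj₁ (bounds i)) (proj₂ (bounds i)) k<p l<p (begin
      residue k (lookup ε⁺ i) (lookup (1 ∷ t) i)  ≡⟨ lookup-zipWith (residue k) i ε⁺ (1 ∷ t) ⟨
      lookup (coords ε⁺ (1 ∷ t) k) i
        ≡⟨ dot-≡⇒lookup-≡ (map ∣_∣ (m₀ ∷ m)) (head-≤ ∷ proj₁ (∷ʳ-≤⁻ le)) levels≡ i ∣mᵢ∣≢0 ⟩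
      lookup (coords ε⁺ (1 ∷ t) l) i              ≡⟨ lookup-zipWith (residue l) i ε⁺ (1 ∷ t) ⟩
      residue l (lookup ε⁺ i) (lookup (1 ∷ t) i)  ∎)
    where
    open ≡-Reasoning
    s = sign m₀
    ε⁺ = map (λ j → s Sign.* sign j) (m₀ ∷ m)

    bounds : ∀ i → 1 ≤ lookup (1 ∷ t) i × lookup (1 ∷ t) i < p
    bounds i = All.lookup⁺ ((≤-refl , nonTrivial⇒n>1 p {{prime⇒nonTrivial pr}}) ∷ t-bounds) i

    ∣mᵢ∣≢0 : lookup (map ∣_∣ (m₀ ∷ m)) i ≢ 0
    ∣mᵢ∣≢0 eq = mᵢ≢0 (ℤ.∣i∣≡0⇒i≡0 (trans (sym (lookup-map i ∣_∣ (m₀ ∷ m))) eq))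

    ∷ʳ-≤⁻ : ∀ {n a b} {xs ys : Vec ℕ n} → Pointwise _≤_ (xs ∷ʳ a) (ys ∷ʳ b) → Pointwise _≤_ xs ys × a ≤ b
    ∷ʳ-≤⁻ {xs = []}    {[]}    (le ∷ [])  = [] , le
    ∷ʳ-≤⁻ {xs = _ ∷ _} {_ ∷ _} (le ∷ les) = le ∷ proj₁ (∷ʳ-≤⁻ les) , proj₂ (∷ʳ-≤⁻ les)

    -- With `s = sign m₀` the first sign is `s * s = +`, so the prepended coordinate is `k` itself,
    -- and the last entries of the two points compare it.
    head-≤ : residue k (s Sign.* s) 1 ≤ residue l (s Sign.* s) 1
    head-≤ = subst₂ _≤_ (sym (residue-1 (s*s≡+ s) k<p)) (sym (residue-1 (s*s≡+ s) l<p)) (proj₂ (∷ʳ-≤⁻ le))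

  S-hasWidth : ∀ {n k} (t : Vec ℕ n) ε → Antichain (S p t ε) k → ∃[ w ] (HasWidth (S p t ε) w × k ≤ w)
  S-hasWidth t ε = antichain⇒hasWidth (S p t ε) (λ x y → Pointwise.decidable _≤?_ (proj₁ x) (proj₁ y))
    (λ i → point p ε t (toℕ i) , toℕ i , Fin.toℕ<n i , refl)
    (λ (x , k , k<p , x≡) → fromℕ< k<p , trans (cong (point p ε t) (Fin.toℕ-fromℕ< k<p)) (sym x≡))

-- Integer roots and the width bound

^-distribʳ-* : ∀ m n o → (n * o) ^ m ≡ n ^ m * o ^ m
^-distribʳ-* zero    n o = refl
^-distribʳ-* (suc m) n o = trans (cong (n * o *_) (^-distribʳ-* m n o)) (interchange n o (n ^ m) (o ^ m))
  where
  interchange : ∀ a b c d → a * b * (c * d) ≡ a * c * (b * d)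
  interchange = ℕRing.solve-∀

-- `B` is the largest integer whose power is at most `p`, so its successor overshoots. The search
-- starts from the solution `1`, and it is bounded by `p` because the exponent is positive.
rootFloor : ∀ n p → 1 ≤ p → ∃[ B ] (1 ≤ B × B ^ suc n ≤ p × p < suc B ^ suc n)
rootFloor n p 1≤p =
  let B , B^d≤p , max = maximum (λ B → B ^ suc n ≤? p) p 1^d≤p bound
  in B , max 1 1^d≤p , B^d≤p , ≰⇒> λ le → 1+n≰n (max (suc B) le)
  where
  1^d≤p : 1 ^ suc n ≤ p
  1^d≤p = subst (_≤ p) (sym (^-zeroˡ (suc n))) 1≤p

  bound : ∀ B → B ^ suc n ≤ p → B ≤ p
  bound zero    _     = z≤n
  bound (suc B) B^d≤p = ≤-trans (m≤m*n (suc B) (suc B ^ n) {{m^n≢0 (suc B) n}}) B^d≤p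

relation⇒width : ∀ {n p} .{{_ : NonZero p}} → Prime p →
  (t : Vec ℕ n) → All (λ tᵢ → 1 ≤ tᵢ × tᵢ < p) t →
  ∀ {B} → 1 ≤ B → (m : Vec ℤ (suc n)) → (∀ i → ∣ lookup m i ∣ ≤ B) →
  ∀ i → lookup m i ≢ 0ℤ → ∀ z → dotℤ m (1 ∷ t) ≡ z ℤ.* + p →
  ∃[ ε ] ∃[ w ] (HasWidth (S p t ε) w × p ≤ suc n * B * w)
relation⇒width {n} {p} pr t t-bounds {B} 1≤B (m₀ ∷ m) m≤B i mᵢ≢0 z m·t≡z*p =
  let w , hasWidth , fibre≤w = S-hasWidth p t ε antichain
  in ε , w , hasWidth , ≤-trans (proj₂ (proj₂ (proj₂ (proj₂ fibre)))) (*-monoʳ-≤ (suc n * B) fibre≤w)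
  where
  open ≤-Reasoning

  s : Sign
  s = sign m₀

  ε : Vec Sign n
  ε = map (λ j → s Sign.* sign j) m

  h : ℕ → ℕ
  h = level p s (m₀ ∷ m) (1 ∷ t)

  h/p<d*B : ∀ k → h k / p < suc n * B
  h/p<d*B k = m<n*o⇒m/o<n (begin-strict
    h k                     ≤⟨ level-≤ p s (m₀ ∷ m) (1 ∷ t) m≤B k ⟩
    suc n * (B * pred p)    ≡⟨ *-assoc (suc n) B (pred p) ⟨
    suc n * B * pred p
      -- Coordinates reach only `pred p`, so the quotient stays strictly below `suc n * B`, which is
      -- then the number of possible values.
      <⟨ *-monoʳ-< (suc n * B) {{m*n≢0 (suc n) B {{_}} {{>-nonZero 1≤B}}}} (≤-reflexive (suc-pred p)) ⟩
    suc n * B * p           ∎)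

  fibre : ∃[ w ] ∃[ g ] (Injective {A = Fin w} {B = Fin p} _≡_ _≡_ g ×
    (∀ i j → h (toℕ (g i)) / p ≡ h (toℕ (g j)) / p) × p ≤ suc n * B * w)
  fibre = largeFibre (suc n * B) (λ k → h (toℕ k) / p) (h/p<d*B ∘ toℕ)

  g : Fin (proj₁ fibre) → Fin p
  g = proj₁ (proj₂ fibre)

  -- Levels are multiples of `p`, so nothing is lost by sorting the points by the quotient.
  levels≡ : ∀ i j → h (toℕ (g i)) ≡ h (toℕ (g j))
  levels≡ i j = begin-equality
    h (toℕ (g i))          ≡⟨ m/n*n≡m (p∣h (toℕ (g i))) ⟨
    h (toℕ (g i)) / p * p  ≡⟨ cong (_* p) (proj₁ (proj₂ (proj₂ (proj₂ fibre))) i j) ⟩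
    h (toℕ (g j)) / p * p  ≡⟨ m/n*n≡m (p∣h (toℕ (g j))) ⟩
    h (toℕ (g j))          ∎
    where
    p∣h : ∀ k → p ∣ h k
    p∣h = p∣level p s (m₀ ∷ m) (1 ∷ t) z m·t≡z*p

  antichain : Antichain (S p t ε) (proj₁ fibre)
  antichain = record
    { element      = λ a → point p ε t (toℕ (g a)) , toℕ (g a) , Fin.toℕ<n (g a) , refl
    ; incomparable = λ {a} {b} a≢b le → a≢b (proj₁ (proj₂ (proj₂ fibre)) (Fin.toℕ-injective
        (level⇒incomparable p pr m₀ m t t-bounds i mᵢ≢0
          (Fin.toℕ<n (g a)) (Fin.toℕ<n (g b)) (levels≡ a b) le)))
    }

  widthAtLeast : ∃[ w ] (HasWidth (S p t ε) w × proj₁ fibre ≤ w)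
  widthAtLeast = S-hasWidth p t ε antichain

largeWidth : ∀ n p .{{_ : NonZero p}} → Prime p →
  (t : Vec ℕ n) → All (λ tᵢ → 1 ≤ tᵢ × tᵢ < p) t →
  ∃[ ε ] ∃[ w ] (HasWidth (S p t ε) w × p ^ n ≤ suc n ^ suc n * w ^ suc n)
largeWidth n p pr t t-bounds =
  let B , 1≤B , B^d≤p , p<[1+B]^d = rootFloor n p (>-nonZero⁻¹ p)
      m , m≤B , (i , mᵢ≢0) , z , m·t≡z*p = smallRelation p B p<[1+B]^d (1 ∷ t)
      ε , w , hasWidth , p≤d*B*w = relation⇒width pr t t-bounds 1≤B m m≤B i mᵢ≢0 z m·t≡z*p
  in ε , w , hasWidth , *-cancelˡ-≤ p (raise B w B^d≤p p≤d*B*w)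
  where
  open ≤-Reasoning

  rotate : ∀ a b c → a * b * c ≡ b * (a * c)
  rotate = ℕRing.solve-∀

  -- In the power with exponent `d = suc n` the unknown `B` enters only as `B ^ d`, which is at most
  -- `p`. Cancelling that one factor `p` afterwards leaves the exponent `n = d - 1` on the left.
  raise : ∀ B w → B ^ suc n ≤ p → p ≤ suc n * B * w → p ^ suc n ≤ p * (suc n ^ suc n * w ^ suc n)
  raise B w B^d≤p p≤d*B*w = begin
    p ^ suc n
      ≤⟨ ^-monoˡ-≤ (suc n) p≤d*B*w ⟩
    (suc n * B * w) ^ suc n
      ≡⟨ ^-distribʳ-* (suc n) (suc n * B) w ⟩
    (suc n * B) ^ suc n * w ^ suc n
      ≡⟨ cong (_* w ^ suc n) (^-distribʳ-* (suc n) (suc n) B) ⟩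
    suc n ^ suc n * B ^ suc n * w ^ suc n
      ≤⟨ *-monoˡ-≤ (w ^ suc n) (*-monoʳ-≤ (suc n ^ suc n) B^d≤p) ⟩
    suc n ^ suc n * p * w ^ suc n
      ≡⟨ rotate (suc n ^ suc n) p (w ^ suc n) ⟩
    p * (suc n ^ suc n * w ^ suc n)
      ∎

-- Passage to rational constants

/1-mono-≤ : ∀ {m n} → m ≤ n → + m ℚ./ 1 ℚ.≤ + n ℚ./ 1
/1-mono-≤ {m} {n} m≤n = ℚ.toℚᵘ-cancel-≤ (begin
  ℚ.toℚᵘ (+ m ℚ./ 1)  ≃⟨ ℚ.toℚᵘ-fromℚᵘ (ℚᵘ.mkℚᵘ (+ m) 0) ⟩
  ℚᵘ.mkℚᵘ (+ m) 0     ≤⟨ ℚᵘ.*≤* (ℤ.*-monoʳ-≤-nonNeg 1ℤ (ℤ.+≤+ m≤n)) ⟩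
  ℚᵘ.mkℚᵘ (+ n) 0     ≃⟨ ℚ.toℚᵘ-fromℚᵘ (ℚᵘ.mkℚᵘ (+ n) 0) ⟨
  ℚ.toℚᵘ (+ n ℚ./ 1)  ∎)
  where open ℚᵘ.≤-Reasoning

-- Fractions in `ℚ` are kept in lowest terms, so the computation moves to `ℚᵘ`, where the equality
-- is a cross multiplication.
1/d*[d*m]≡m : ∀ d .{{_ : NonZero d}} m → (1ℤ ℚ./ d) ℚ.* (+ (d * m) ℚ./ 1) ≡ + m ℚ./ 1
1/d*[d*m]≡m d@(suc d-1) m = ℚ.toℚᵘ-injective (begin
  ℚ.toℚᵘ ((1ℤ ℚ./ d) ℚ.* (+ (d * m) ℚ./ 1))
    ≈⟨ ℚ.toℚᵘ-homo-* (1ℤ ℚ./ d) (+ (d * m) ℚ./ 1) ⟩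
  ℚ.toℚᵘ (1ℤ ℚ./ d) ℚᵘ.* ℚ.toℚᵘ (+ (d * m) ℚ./ 1)
    ≈⟨ ℚᵘ.*-cong (ℚ.toℚᵘ-fromℚᵘ (ℚᵘ.mkℚᵘ 1ℤ d-1)) (ℚ.toℚᵘ-fromℚᵘ (ℚᵘ.mkℚᵘ (+ (d * m)) 0)) ⟩
  ℚᵘ.mkℚᵘ 1ℤ d-1 ℚᵘ.* ℚᵘ.mkℚᵘ (+ (d * m)) 0
    ≈⟨ ℚᵘ.*≡* cross ⟩
  ℚᵘ.mkℚᵘ (+ m) 0
    ≈⟨ ℚ.toℚᵘ-fromℚᵘ (ℚᵘ.mkℚᵘ (+ m) 0) ⟨
  ℚ.toℚᵘ (+ m ℚ./ 1)
    ∎)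
  where
  open import Relation.Binary.Reasoning.Setoid ℚᵘ.≃-setoid
  rearrange : ∀ d m → 1ℤ ℤ.* (d ℤ.* m) ℤ.* 1ℤ ≡ m ℤ.* (d ℤ.* 1ℤ)
  rearrange = ℤRing.solve-∀
  cross : 1ℤ ℤ.* + (d * m) ℤ.* 1ℤ ≡ + m ℤ.* (+ (d * 1))
  cross = trans (cong (λ e → 1ℤ ℤ.* e ℤ.* 1ℤ) (ℤ.pos-* d m))
    (trans (rearrange (+ d) (+ m)) (cong (+ m ℤ.*_) (sym (ℤ.pos-* d 1))))

-- For `e = d` this cancels the power of the constant against `d ^ d`. With `m` left general, each
-- induction step can move one factor `d` into it.
pow-1/d : ∀ d .{{_ : NonZero d}} e m →
  pow ℚ.+-*-rawSemiring (1ℤ ℚ./ d) e ℚ.* (+ (d ^ e * m) ℚ./ 1) ≡ + m ℚ./ 1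
pow-1/d d zero    m = trans (ℚ.*-identityˡ _) (cong (λ k → + k ℚ./ 1) (*-identityˡ m))
pow-1/d d (suc e) m = begin
  c ℚ.* P ℚ.* (+ (d * d ^ e * m) ℚ./ 1)
    ≡⟨ cong (λ k → c ℚ.* P ℚ.* (+ k ℚ./ 1)) (rearrange d (d ^ e) m) ⟩
  c ℚ.* P ℚ.* (+ (d ^ e * (d * m)) ℚ./ 1)
    ≡⟨ ℚ.*-assoc c P _ ⟩
  c ℚ.* (P ℚ.* (+ (d ^ e * (d * m)) ℚ./ 1))
    ≡⟨ cong (c ℚ.*_) (pow-1/d d e (d * m)) ⟩
  c ℚ.* (+ (d * m) ℚ./ 1)
    ≡⟨ 1/d*[d*m]≡m d m ⟩
  + m ℚ./ 1
    ∎
  where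
  open ≡-Reasoning
  c = 1ℤ ℚ./ d
  P = pow ℚ.+-*-rawSemiring c e
  rearrange : ∀ a b c → a * b * c ≡ b * (a * c)
  rearrange = ℕRing.solve-∀

pow-nonNeg : ∀ c .{{_ : ℚ.NonNegative c}} e → ℚ.NonNegative (pow ℚ.+-*-rawSemiring c e)
pow-nonNeg c zero    = _
pow-nonNeg c (suc e) = ℚ.nonNeg*nonNeg⇒nonNeg c _ {{pow-nonNeg c e}}

theorem4p1 : (d : ℕ) → d > 3 →
    ∃[ c ] (0ℚ <ℚ c ×
    ((p : ℕ) .{{_ : NonZero p}} → Prime p →
    (t : Vec ℕ (pred d)) → All (λ tᵢ → 1 ≤ tᵢ × tᵢ < p) t →
    ∃[ ε ] ∃[ w ] (HasWidth (S p t ε) w × c · p ^[1-1/ d ]≤ w)))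
theorem4p1 d@(suc n) _ = c , ℚ.positive⁻¹ c {{c-pos}} , λ p pr t t-bounds →
  let ε , w , hasWidth , p^n≤ = largeWidth n p pr t t-bounds
  in ε , w , hasWidth , ℚ.≤-trans
    (ℚ.*-monoˡ-≤-nonNeg (pow ℚ.+-*-rawSemiring c d) {{pow-nonNeg c {{ℚ.pos⇒nonNeg c {{c-pos}}}} d}} (/1-mono-≤ p^n≤))
    (ℚ.≤-reflexive (pow-1/d d d (w ^ d)))
  where
  -- From `p ≤ d * B * w` with `B` at most the d-th root of `p`, the loss is exactly the factor `d`.
  c = 1ℤ ℚ./ d

  c-pos : ℚ.Positive c
  c-pos = ℚ.normalize-pos 1 d
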